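{- Let $\alpha,\beta$ be types. For every $a:\alpha$ and every function $f:\alpha\to \mathrm{unit}+(\mathcal{P}(\mathrm{Node}_\beta)\times\alpha)$, the corecursion operator $\mathrm{LList\_corec}$ satisfies $$\mathrm{LList\_corec}\,a\,f=\begin{cases}\mathrm{NIL} & \text{if } f\,a=\mathrm{Inl}\,(),\\ \mathrm{CONS}\,x\,(\mathrm{LList\_corec}\,b\,f) & \text{if } f\,a=\mathrm{Inr}\,(x,b).\end{cases}$$
   Context: Setting: classical higher-order logic (total functions). $\mathbb{N}$ denotes the natural numbers including $0$; $\mathrm{unit}$ is the one-element type with sole value $()$; $\sigma+\tau$ is the disjoint sum type with injections $\mathrm{Inl},\mathrm{Inr}$. Nodes and trees: for a type $\beta$, $\mathrm{Node}_\beta$ is the type of pairs $(g,y)$ with $g:\mathbb{N}\to\mathbb{N}$, $y:\beta+\mathbb{N}$, such that $g\,n=0$ for some $n$. A construction (tree) is an arbitrary set of nodes, i.e. an element of $\mathcal{P}(\mathrm{Node}_\beta)$. For $k\in\mathbb{N}$ and $g:\mathbb{N}\to\mathbb{N}$, $\mathrm{Push}\,k\,g:\mathbb{N}\to\mathbb{N}$ is given by $(\mathrm{Push}\,k\,g)(0)=k+1$ and $(\mathrm{Push}\,k\,g)(j+1)=g(j)$. Define $M\cdot N=\{(\mathrm{Push}\,0\,g,y)\mid (g,y)\in M\}\cup\{(\mathrm{Push}\,1\,g,y)\mid (g,y)\in N\}$, $\mathrm{Numb}\,k=\{(\lambda i.0,\ \mathrm{Inr}\,k)\}$, $\mathrm{In0}\,M=\mathrm{Numb}\,0\cdot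 M$, $\mathrm{In1}\,N=\mathrm{Numb}\,1\cdot N$, $\mathrm{NIL}=\mathrm{In0}(\mathrm{Numb}\,0)$, $\mathrm{CONS}\,M\,N=\mathrm{In1}(M\cdot N)$. Corecursion: define $\mathrm{lcorf}$ by primitive recursion on $k\in\mathbb{N}$: $\mathrm{lcorf}\,0\,a\,f=\emptyset$, and $\mathrm{lcorf}\,(k+1)\,a\,f$ equals $\mathrm{NIL}$ if $f\,a=\mathrm{Inl}\,()$ and equals $\mathrm{CONS}\,x\,(\mathrm{lcorf}\,k\,b\,f)$ if $f\,a=\mathrm{Inr}\,(x,b)$. Then $\mathrm{LList\_corec}\,a\,f=\bigcup_{k\in\mathbb{N}}\mathrm{lcorf}\,k\,a\,f$. -}

module Defs where

open import Data.Nat.Base using (ℕ; zero; suc)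
open import Data.Product.Base using (Σ; ∃; _×_; _,_; proj₁; proj₂)
open import Data.Sum.Base using (_⊎_; inj₁; inj₂; [_,_]′)
open import Data.Unit.Base using (⊤)
open import Data.Empty.Polymorphic using (⊥)
open import Level using (Level) renaming (suc to lsuc)
open import Relation.Binary.Core using (Rel)
open import Relation.Binary.Definitions using (_Respects_; Symmetric; Transitive)
open import Relation.Binary.PropositionalEquality.Core
  using (_≡_; _≗_; refl; sym; trans)
open import Relation.Unary using (Pred; _∪_; ⋃; _≐_)

private
  variable
    a b : Level
    α : Set a
    β : Set b

Node : Set b → Set b
Node β = Σ ((ℕ → ℕ) × (β ⊎ ℕ)) λ (g , _) → ∃ λ n → g n ≡ 0

infix 4 _≈_ _≋_

-- Equality of nodes in extensional logic: functions are compared pointwise,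
-- and the evidence that g has a zero is ignored.
record _≈_ {β : Set b} (m n : Node β) : Set b where
  constructor _,_
  field
    fun≗   : proj₁ (proj₁ m) ≗ proj₁ (proj₁ n)
    label≡ : proj₂ (proj₁ m) ≡ proj₂ (proj₁ n)

≈-sym : Symmetric (_≈_ {β = β})
≈-sym (g≗h , y≡z) = (λ i → sym (g≗h i)) , sym y≡z

≈-trans : Transitive (_≈_ {β = β})
≈-trans (g≗h , x≡y) (h≗k , y≡z) =
  (λ i → trans (g≗h i) (h≗k i)) , trans x≡y y≡z

-- 𝒫 (Node β): the sets of nodes, i.e. the predicates on nodes that are
-- invariant under extensional equality of nodes.
record Tree (β : Set b) : Set (lsuc b) where
  field
    member  : Pred (Node β) b
    respect : member Respects _≈_

open Tree public

_≋_ : Rel (Tree {b} β) b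
M ≋ N = member M ≐ member N

Push : ℕ → (ℕ → ℕ) → (ℕ → ℕ)
Push k g zero    = suc k
Push k g (suc j) = g j

pushNode : ℕ → Node β → Node β
pushNode k ((g , y) , (n , gn≡0)) = (Push k g , y) , (suc n , gn≡0)

∅ᵗ : Tree β
∅ᵗ .member _ = ⊥
∅ᵗ .respect _ ()

｛_｝ᵗ : Node β → Tree β
｛ m ｝ᵗ .member n = n ≈ m
｛ m ｝ᵗ .respect n≈n′ n≈m = ≈-trans (≈-sym n≈n′) n≈m

infixr 6 _∪ᵗ_

_∪ᵗ_ : Tree β → Tree β → Tree β
(M ∪ᵗ N) .member = member M ∪ member N
(M ∪ᵗ N) .respect n≈n′ (inj₁ n∈M) = inj₁ (respect M n≈n′ n∈M)
(M ∪ᵗ N) .respect n≈n′ (inj₂ n∈N) = inj₂ (respect N n≈n′ n∈N)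

⋃ᵗ : (ℕ → Tree β) → Tree β
⋃ᵗ M .member = ⋃ ℕ (λ k → member (M k))
⋃ᵗ M .respect n≈n′ (k , n∈Mk) = k , respect (M k) n≈n′ n∈Mk

-- { (Push k g , y) ∣ (g , y) ∈ M }
pushAll : ℕ → Tree β → Tree β
pushAll k M .member n = ∃ λ m → member M m × n ≈ pushNode k m
pushAll k M .respect n≈n′ (m , m∈M , n≈km) =
  m , m∈M , ≈-trans (≈-sym n≈n′) n≈km

infixr 7 _·_

_·_ : Tree β → Tree β → Tree β
M · N = pushAll 0 M ∪ᵗ pushAll 1 N

Numb : ℕ → Tree β
Numb k = ｛ ((λ _ → 0) , inj₂ k) , (0 , refl) ｝ᵗ

In0 : Tree β → Tree β
In0 M = Numb 0 · M

In1 : Tree β → Tree β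
In1 N = Numb 1 · N

NIL : Tree β
NIL = In0 (Numb 0)

CONS : Tree β → Tree β → Tree β
CONS M N = In1 (M · N)

lcorf : ℕ → α → (α → ⊤ ⊎ (Tree β × α)) → Tree β
lcorf zero    a f = ∅ᵗ
lcorf (suc k) a f = [ (λ _ → NIL) , (λ (x , b) → CONS x (lcorf k b f)) ]′ (f a)

LList-corec : α → (α → ⊤ ⊎ (Tree β × α)) → Tree β
LList-corec a f = ⋃ᵗ (λ k → lcorf k a f)

{-# OPTIONS --safe #-}

-- CONS is monotone and commutes with unions over ℕ in its second argument,
-- and the (k+1)-st approximation is one CONS applied to the k-th; so unfolding
-- the union once only shifts its index, the 0-th approximation being empty.

module Submission where

open import Level using (Level)
open import Data.Nat.Base using (ℕ; suc)
open import Data.Product.Base using (_×_; _,_; proj₁; proj₂)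
open import Data.Sum.Base using (_⊎_; inj₁; inj₂; [_,_]′)
open import Data.Unit.Base using (⊤)
open import Relation.Unary using (_⊆_)
open import Defs

private
  variable
    a b : Level
    α : Set a
    β : Set b

·-monoʳ : (M : Tree β) {N N′ : Tree β} → member N ⊆ member N′ → member (M · N) ⊆ member (M · N′)
·-monoʳ M N⊆N′ (inj₁ p)              = inj₁ p
·-monoʳ M N⊆N′ (inj₂ (m , m∈N , eq)) = inj₂ (m , N⊆N′ m∈N , eq)

-- A node of the product comes from a single node of one factor, so one index suffices.
·-⋃ʳ : (M : Tree β) (N : ℕ → Tree β) → member (M · ⋃ᵗ N) ⊆ member (⋃ᵗ (λ k → M · N k))
-- This half does not involve `N`, so the index 0 is arbitrary.
·-⋃ʳ M N (inj₁ p)                     = 0 , inj₁ p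
·-⋃ʳ M N (inj₂ (m , (k , m∈Nk) , eq)) = k , inj₂ (m , m∈Nk , eq)

CONS-⋃ʳ : (M : Tree β) (N : ℕ → Tree β) → ⋃ᵗ (λ k → CONS M (N k)) ≋ CONS M (⋃ᵗ N)
CONS-⋃ʳ M N .proj₁ (k , p) =
  ·-monoʳ (Numb 1) {M · N k} {M · ⋃ᵗ N} (·-monoʳ M {N k} {⋃ᵗ N} (k ,_)) p
-- The union leaves the inner product first, then the outer one with `Numb 1`.
CONS-⋃ʳ M N .proj₂ p =
  ·-⋃ʳ (Numb 1) (λ k → M · N k)
    (·-monoʳ (Numb 1) {M · ⋃ᵗ N} {⋃ᵗ (λ k → M · N k)} (·-⋃ʳ M N) p)

-- Stated for an arbitrary s in place of f a, so that one can split on s.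
⋃-lcorf-suc : (f : α → ⊤ ⊎ (Tree β × α)) (s : ⊤ ⊎ (Tree β × α)) →
  ⋃ᵗ (λ k → [ (λ _ → NIL) , (λ (x , b) → CONS x (lcorf k b f)) ]′ s)
    ≋ [ (λ _ → NIL) , (λ (x , b) → CONS x (LList-corec b f)) ]′ s
-- The family is constantly `NIL`; any index would serve.
⋃-lcorf-suc f (inj₁ _)       = proj₂ , (0 ,_)
⋃-lcorf-suc f (inj₂ (x , b)) = CONS-⋃ʳ x (λ k → lcorf k b f)

mainTheorem1 : ∀ {ℓ₁ ℓ₂ : Level} {α : Set ℓ₁} {β : Set ℓ₂} (a : α) (f : α → ⊤ ⊎ (Tree β × α)) →
    LList-corec a f ≋ [ (λ _ → NIL) , (λ (x , b) → CONS x (LList-corec b f)) ]′ (f a)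
-- Index 0 is impossible, since `lcorf 0 a f` is empty.
mainTheorem1 a f .proj₁ (suc k , p) = ⋃-lcorf-suc f (f a) .proj₁ (k , p)
mainTheorem1 a f .proj₂ p =
  let k , q = ⋃-lcorf-suc f (f a) .proj₂ p in suc k , q
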